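{- Consider the following five axioms on a binary operation $\to$ on a bounded lattice $L$, each required for all $a,b,c\in L$: (1) $1\to a\leq a$; (2) $a\wedge b\leq a\to b$; (3) $a\to b\leq a\to(a\wedge b)$; (4) $a\to(b\wedge c)\leq a\to b$; (5) $a\to((a\wedge b)\to c)\leq (a\wedge b)\to c$. These axioms are mutually independent: for each $i\in\{1,2,3,4,5\}$ there exist a bounded lattice $L$ and a binary operation $\to$ on $L$ such that axiom $(i)$ fails while the other four axioms hold.
   Context: A binary operation on a bounded lattice satisfying all five axioms is called a preconditional; $0$ and $1$ denote the bottom and top of the lattice. -}

module Defs where

open import Level using (Level; _⊔_)
open import Algebra.Core using (Op₂)
open import Data.Fin.Base using (Fin)
open import Data.Fin.Patterns using (0F; 1F; 2F; 3F; 4F)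
open import Relation.Binary.Lattice.Bundles using (BoundedLattice)

private
  variable
    c ℓ₁ ℓ₂ : Level

module PreconditionalAxioms
  (L : BoundedLattice c ℓ₁ ℓ₂)
  (_⇾_ : Op₂ (BoundedLattice.Carrier L))
  where

  open BoundedLattice L using (Carrier; _≤_; _∧_; ⊤)

  Axiom₁ : Set (c ⊔ ℓ₂)
  Axiom₁ = (a : Carrier) → (⊤ ⇾ a) ≤ a

  Axiom₂ : Set (c ⊔ ℓ₂)
  Axiom₂ = (a b : Carrier) → (a ∧ b) ≤ (a ⇾ b)

  Axiom₃ : Set (c ⊔ ℓ₂)
  Axiom₃ = (a b : Carrier) → (a ⇾ b) ≤ (a ⇾ (a ∧ b))

  Axiom₄ : Set (c ⊔ ℓ₂)
  Axiom₄ = (a b c : Carrier) → (a ⇾ (b ∧ c)) ≤ (a ⇾ b)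

  Axiom₅ : Set (c ⊔ ℓ₂)
  Axiom₅ = (a b c : Carrier) → (a ⇾ ((a ∧ b) ⇾ c)) ≤ ((a ∧ b) ⇾ c)

  Axiom : Fin 5 → Set (c ⊔ ℓ₂)
  Axiom 0F = Axiom₁
  Axiom 1F = Axiom₂
  Axiom 2F = Axiom₃
  Axiom 3F = Axiom₄
  Axiom 4F = Axiom₅

{-# OPTIONS --safe #-}
-- All five countermodels live on the three-element chain, where each axiom is
-- decidable by exhaustion.
module Submission where

open import Defs
open import Level using (0ℓ)
open import Algebra.Core using (Op₂)
open import Algebra.Definitions using (Congruent₂)
open import Data.Fin.Base using (Fin)
open import Data.Product.Base using (Σ-syntax; _×_)
open import Relation.Binary.Lattice.Bundles using (BoundedLattice)
open import Relation.Binary.PropositionalEquality.Core using (_≢_)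
open import Relation.Nullary.Negation.Core using (¬_)

import Algebra.Construct.NaturalChoice.Max as Max
import Algebra.Construct.NaturalChoice.Min as Min
open import Data.Fin.Base using (zero; fromℕ)
open import Data.Fin.Patterns using (0F; 1F; 2F; 3F; 4F)
open import Data.Fin.Properties
  using (_≟_; _≤?_; all?; ≤fromℕ; ≤-isPartialOrder; ≤-totalOrder)
open import Data.Nat.Base using (ℕ; suc; z≤n)
open import Data.Product.Base using (_,_)
open import Relation.Binary.PropositionalEquality.Core using (cong₂)
open import Relation.Nullary.Decidable.Core
  using (Dec; ¬?; _×-dec_; _→-dec_; from-yes)

-- On 0 < 1 < 2 each axiom has its own culprit: constant top breaks (1) at a = 0; constant bottom
-- breaks (2) at a = b = 2; second projection breaks (3) whenever a < b. Axiom (4) says that `a ⇾_`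
-- is monotone, so a row decreasing in its argument breaks it. Łukasiewicz implication lacks
-- contraction, hence breaks (5). The other axioms are a finite check.

chain : ℕ → BoundedLattice 0ℓ 0ℓ 0ℓ
chain n = record
  { Carrier = Fin (suc n)
  ; _∨_ = _⊔_
  ; _∧_ = _⊓_
  ; ⊤ = fromℕ n
  ; ⊥ = zero
  ; isBoundedLattice = record
    { isLattice = record
      { isPartialOrder = ≤-isPartialOrder
      ; supremum = λ x y → x≤x⊔y x y , x≤y⊔x x y , λ _ → ⊔-lub
      ; infimum = λ x y → x⊓y≤x x y , x⊓y≤y x y , λ _ → ⊓-glb
      }
    ; maximum = ≤fromℕ
    ; minimum = λ _ → z≤n
    }
  }
  where
  open Max (≤-totalOrder (suc n)) using (_⊔_; x≤x⊔y; x≤y⊔x; ⊔-lub)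
  open Min (≤-totalOrder (suc n)) using (_⊓_; x⊓y≤x; x⊓y≤y; ⊓-glb)

module _ {n : ℕ} (_⇾_ : Op₂ (Fin (suc n))) where
  open BoundedLattice (chain n) using (_∧_; ⊤)
  open PreconditionalAxioms (chain n) _⇾_ using (Axiom)

  axiom? : (i : Fin 5) → Dec (Axiom i)
  axiom? 0F = all? λ a → (⊤ ⇾ a) ≤? a
  axiom? 1F = all? λ a → all? λ b → (a ∧ b) ≤? (a ⇾ b)
  axiom? 2F = all? λ a → all? λ b → (a ⇾ b) ≤? (a ⇾ (a ∧ b))
  axiom? 3F = all? λ a → all? λ b → all? λ c →
    (a ⇾ (b ∧ c)) ≤? (a ⇾ b)
  axiom? 4F = all? λ a → all? λ b → all? λ c →
    (a ⇾ ((a ∧ b) ⇾ c)) ≤? ((a ∧ b) ⇾ c)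

-- The last operation is Łukasiewicz implication; the table for 3F was found by
-- exhaustive search.
countermodel : Fin 5 → Op₂ (Fin 3)
countermodel 0F _ _ = 2F
countermodel 1F _ _ = 0F
countermodel 2F _ b = b
countermodel 3F 0F _ = 2F
-- The decreasing row: `1 ⇾ (1 ∧ 0)` is 2, but `1 ⇾ 1` is 1.
countermodel 3F 1F 0F = 2F
countermodel 3F 1F _ = 1F
countermodel 3F 2F b = b
countermodel 4F 0F _ = 2F
-- Contraction fails here: `1 ⇾ (1 ⇾ 0)` is 2, but `1 ⇾ 0` is 1.
countermodel 4F 1F 0F = 1F
countermodel 4F 1F _ = 2F
countermodel 4F 2F b = b

-- The axiom indices range over a finite type too, so the whole claim is one closed decision;
-- `from-yes` typechecks because it evaluates to yes.
countermodel-separates : (i : Fin 5) →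
  let open PreconditionalAxioms (chain 2) (countermodel i) in
  ¬ Axiom i × ((j : Fin 5) → j ≢ i → Axiom j)
countermodel-separates = from-yes (all? λ i →
  ¬? (axiom? (countermodel i) i) ×-dec
  all? λ j → ¬? (j ≟ i) →-dec axiom? (countermodel i) j)

fact1 : (i : Fin 5) →
    Σ[ L ∈ BoundedLattice 0ℓ 0ℓ 0ℓ ]
    Σ[ _⇾_ ∈ Op₂ (BoundedLattice.Carrier L) ]
    ( Congruent₂ (BoundedLattice._≈_ L) _⇾_
    × ¬ PreconditionalAxioms.Axiom L _⇾_ i
    × ((j : Fin 5) → j ≢ i → PreconditionalAxioms.Axiom L _⇾_ j))
fact1 i =
  chain 2 , countermodel i , cong₂ (countermodel i) , countermodel-separates i
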